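{- Let $\mathscr C_\omega$ and $\mathscr C_2$ be the Fraïssé limits of the class of finite $C$-relations and of the class of finite binary $C$-relations respectively. Let $\mathrm{C_4}$ be the $C$-relation on the 4-element set $\{\mathrm a, \mathrm b, \mathrm c, \mathrm d\}$ uniquely determined by declaring $C(\mathrm a; \mathrm c, \mathrm d)$, $C(\mathrm b; \mathrm c, \mathrm d)$, and $C(\mathrm c; \mathrm a, \mathrm b)$. Then $\mathrm d(\mathscr C_2 : \mathrm{C_4}) = \mathrm d(\mathscr C_\omega : \mathrm{C_4}) = \infty$.
   Context: A pseudotree is a structure $T$ with a (reflexive, antisymmetric, transitive) order relation $\leq$ and a binary function $\wedge$ such that $\sup\{x \in T : x \leq a,\ x \leq b\} = a \wedge b$ for all $a,b \in T$ (in particular this supremum exists), and such that for each $a \in T$ the set $\{x \in T : x \leq a\}$ is linearly ordered by $\leq$. A pseudotree $T$ is binary if for every $a \in T$ and $x,y,z > a$ it is not the case that $a = x\wedge y = x \wedge z = y \wedge z$. A finite set $L$ equipped with a ternary relation $C$ is a (finite) $C$-relation structure, or just a $C$-relation, if there is a finite pseudotree $T$ such that the set $L$ consists of maximal elements of $T$, and $C(a;b,c)$ holds exactly when $a \wedge b < b \wedge c$ (for $a,b,c\in L$). It is a binary $C$-relation if $T$ can be taken to be a binary pseudotree. The class of finite $C$-relations and the class of finite binary $C$-relations are both Fraïssé classes (in the language with one ternary relation symbol). For structures $A, B$, $\binom{B}{A}$ is the set of all substructures of $B$ isomorphic to $A$. A natural number $\ell$ is identified with $\{0,\dots,\ell-1\}$.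 For $\ell \in \omega$ write $B \to (B)^A_\ell$ if for every function $c\colon \binom{B}{A} \to \ell$ there exists $D \in \binom{B}{B}$ such that the image $c\left[\binom{D}{A}\right]$ is not equal to $\ell$ (i.e. some color is omitted). The big Ramsey degree $\mathrm d(B : A)$ of $A$ in $B$ is the smallest $\ell\in\omega$ for which $B \to (B)^A_{\ell+1}$, and $\mathrm d(B:A) = \infty$ if no such $\ell$ exists. -}

module Defs where

open import Level using (0ℓ) renaming (suc to lsuc)
open import Data.Fin.Base using (Fin; _↑ˡ_)
open import Data.Fin.Patterns using (0F; 1F; 2F; 3F; 4F; 5F; 6F)
open import Data.Fin.Properties using (_≟_; all?; ↑ˡ-injective)
open import Data.Nat.Base as ℕ using (ℕ)
open import Data.Product.Base using (_×_; _,_; ∃-syntax)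
open import Data.Sum.Base using (_⊎_)
open import Data.Vec.Base using (Vec; []; _∷_; lookup)
open import Function.Bundles using (_↔_; _⇔_; mk↔ₛ′)
open import Function.Construct.Identity using (↔-id; ⇔-id)
open import Function.Definitions using (Injective; Surjective)
open import Relation.Binary.Core using (Rel)
open import Relation.Binary.Definitions using (Decidable)
open import Relation.Binary.PropositionalEquality
  using (_≡_; refl; sym; trans; cong; isEquivalence)
open import Relation.Binary.Structures using (IsPartialOrder)
import Relation.Binary.Construct.NonStrictToStrict as Strict
open import Relation.Nullary using (¬_)
open import Relation.Nullary.Decidable using (from-yes; _×-dec_; _⊎-dec_; _→-dec_)
open import Relation.Unary using (Pred; _⊆_; _≐_; Universal)

Finite : Set → Set
Finite X = ∃[ n ] (X ↔ Fin n)

Countable : Set → Set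
Countable X = Finite X ⊎ (X ↔ ℕ)

------------------------------------------------------------------------
-- Structures with one ternary relation

record Structure : Set₁ where
  constructor structure
  field
    Carrier : Set
    C       : Carrier → Carrier → Carrier → Set

open Structure public using (Carrier; C)

record IsEmbedding (A B : Structure) (f : Carrier A → Carrier B) : Set where
  field
    injective : Injective _≡_ _≡_ f
    C-⇔       : ∀ x y z → C A x y z ⇔ C B (f x) (f y) (f z)

Embeds : Structure → Structure → Set
Embeds A B = ∃[ f ] IsEmbedding A B f

IsAutomorphism : (B : Structure) → (Carrier B → Carrier B) → Set
IsAutomorphism B σ = IsEmbedding B B σ × Surjective _≡_ _≡_ σ

------------------------------------------------------------------------
-- Pseudotrees

record Pseudotree : Set₁ where
  infix  4 _≤_
  infixl 7 _∧_
  field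
    Node           : Set
    _≤_            : Rel Node 0ℓ
    _∧_            : Node → Node → Node
    isPartialOrder : IsPartialOrder _≡_ _≤_

  UpperBound : Pred Node 0ℓ → Pred Node 0ℓ
  UpperBound P u = ∀ x → P x → x ≤ u

  IsSup : Pred Node 0ℓ → Pred Node 0ℓ
  IsSup P s = UpperBound P s × (∀ u → UpperBound P u → s ≤ u)

  field
    ∧-sup    : ∀ a b → IsSup (λ x → x ≤ a × x ≤ b) (a ∧ b)
    ↓-linear : ∀ a x y → x ≤ a → y ≤ a → x ≤ y ⊎ y ≤ x

  open Strict _≡_ _≤_ public using (_<_)

  Maximal : Pred Node 0ℓ
  Maximal m = ∀ x → m ≤ x → m ≡ x

  Binary : Set
  Binary = ∀ a x y z → a < x → a < y → a < z →
           ¬ (a ≡ x ∧ y × a ≡ x ∧ z × a ≡ y ∧ z)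

------------------------------------------------------------------------
-- Finite C-relations

record IsCRelationOf (L : Structure) (T : Pseudotree) : Set where
  open Pseudotree T
  field
    leaf           : Carrier L → Node
    leaf-injective : Injective _≡_ _≡_ leaf
    leaf-maximal   : ∀ x → Maximal (leaf x)
    C-⇔            : ∀ a b c →
      C L a b c ⇔ (leaf a ∧ leaf b < leaf b ∧ leaf c)

IsFiniteCRelation : Pred Structure (lsuc 0ℓ)
IsFiniteCRelation L =
  Finite (Carrier L) ×
  ∃[ T ] (Finite (Pseudotree.Node T) × IsCRelationOf L T)

IsFiniteBinaryCRelation : Pred Structure (lsuc 0ℓ)
IsFiniteBinaryCRelation L =
  Finite (Carrier L) ×
  ∃[ T ] (Finite (Pseudotree.Node T) × Pseudotree.Binary T × IsCRelationOf L T)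

------------------------------------------------------------------------
-- Fraïssé limits

Ultrahomogeneous : Structure → Set₁
Ultrahomogeneous B =
  ∀ A → Finite (Carrier A) →
  ∀ f g → IsEmbedding A B f → IsEmbedding A B g →
  ∃[ σ ] (IsAutomorphism B σ × (∀ x → σ (f x) ≡ g x))

-- The language is relational, so the finitely generated substructures of B
-- are the finite ones.
record IsFraïsséLimit (K : Pred Structure (lsuc 0ℓ)) (B : Structure) : Set₁ where
  field
    countable        : Countable (Carrier B)
    age              : ∀ A → K A ⇔ (Finite (Carrier A) × Embeds A B)
    ultrahomogeneous : Ultrahomogeneous B

------------------------------------------------------------------------
-- Big Ramsey degrees

range : {X Y : Set} → (X → Y) → Pred Y 0ℓ
range f y = ∃[ x ] f x ≡ y

-- Substructures are given by their underlying sets, which are predicates;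
-- isomorphisms from A onto the substructure S are embeddings with range S.
record Copy (B A : Structure) : Set₁ where
  field
    set         : Pred (Carrier B) 0ℓ
    iso         : Carrier A → Carrier B
    isEmbedding : IsEmbedding A B iso
    onto        : set ≐ range iso

open Copy public using (set)

-- A colour depends only on the substructure, not on the chosen isomorphism,
-- and predicates with the same elements are the same substructure.
record Colouring (B A : Structure) (ℓ : ℕ) : Set₁ where
  field
    colour   : Copy B A → Fin ℓ
    respects : ∀ S S′ → set S ≐ set S′ → colour S ≡ colour S′

open Colouring public using (colour)

Image : ∀ {B A ℓ} → Colouring B A ℓ → Copy B B → Pred (Fin ℓ) (lsuc 0ℓ)
Image {B} {A} c D i = ∃[ S ] (set {B} {A} S ⊆ set D × colour c S ≡ i)

-- Arrow B A ℓ is B → (B)^A_ℓ.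
Arrow : Structure → Structure → ℕ → Set₁
Arrow B A ℓ = (c : Colouring B A ℓ) → ∃[ D ] ¬ Universal (Image c D)

data ℕ∞ : Set where
  fin : ℕ → ℕ∞
  ∞   : ℕ∞

-- BigRamseyDegree B A d is d(B : A) = d.
BigRamseyDegree : Structure → Structure → ℕ∞ → Set₁
BigRamseyDegree B A (fin ℓ) =
  Arrow B A (ℕ.suc ℓ) × (∀ k → k ℕ.< ℓ → ¬ Arrow B A (ℕ.suc k))
BigRamseyDegree B A ∞ = ¬ (∃[ ℓ ] Arrow B A (ℕ.suc ℓ))

------------------------------------------------------------------------
-- The C-relation C₄

data Label : Set where
  a b c d : Label

-- The relation is unique up to _⇔_ only, hence a predicate rather than
-- a single structure.
record IsC₄ (C : Label → Label → Label → Set) : Set₁ where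
  field
    isFiniteCRelation : IsFiniteCRelation (structure Label C)
    a∣cd              : C a c d
    b∣cd              : C b c d
    c∣ab              : C c a b

module C₄-Exists where

  -- 0F, 1F, 2F, 3F are the leaves a, b, c, d; 4F is a ∧ b, 5F is c ∧ d and
  -- 6F is the root.
  meets : Vec (Vec (Fin 7) 7) 7
  meets =
    (0F ∷ 4F ∷ 6F ∷ 6F ∷ 4F ∷ 6F ∷ 6F ∷ []) ∷
    (4F ∷ 1F ∷ 6F ∷ 6F ∷ 4F ∷ 6F ∷ 6F ∷ []) ∷
    (6F ∷ 6F ∷ 2F ∷ 5F ∷ 6F ∷ 5F ∷ 6F ∷ []) ∷
    (6F ∷ 6F ∷ 5F ∷ 3F ∷ 6F ∷ 5F ∷ 6F ∷ []) ∷
    (4F ∷ 4F ∷ 6F ∷ 6F ∷ 4F ∷ 6F ∷ 6F ∷ []) ∷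
    (6F ∷ 6F ∷ 5F ∷ 5F ∷ 6F ∷ 5F ∷ 6F ∷ []) ∷
    (6F ∷ 6F ∷ 6F ∷ 6F ∷ 6F ∷ 6F ∷ 6F ∷ []) ∷ []

  infix  4 _≤_ _≤?_ _<_
  infixl 7 _∧_

  _∧_ : Fin 7 → Fin 7 → Fin 7
  m ∧ n = lookup (lookup meets m) n

  _≤_ : Rel (Fin 7) 0ℓ
  m ≤ n = m ∧ n ≡ m

  _≤?_ : Decidable _≤_
  m ≤? n = m ∧ n ≟ m

  isPartialOrder : IsPartialOrder _≡_ _≤_
  isPartialOrder = record
    { isPreorder = record
      { isEquivalence = isEquivalence
      ; reflexive     = λ { {m} refl → from-yes (all? λ m → m ≤? m) m }
      ; trans         = λ {l} {m} {n} → from-yes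
          (all? λ l → all? λ m → all? λ n → (l ≤? m) →-dec (m ≤? n) →-dec (l ≤? n))
          l m n
      }
    ; antisym = λ {m} {n} → from-yes
        (all? λ m → all? λ n → (m ≤? n) →-dec (n ≤? m) →-dec (m ≟ n)) m n
    }

  tree : Pseudotree
  tree = record
    { Node           = Fin 7
    ; _≤_            = _≤_
    ; _∧_            = _∧_
    ; isPartialOrder = isPartialOrder
    ; ∧-sup          = λ m n → (λ x (x≤m , x≤n) → greatest m n x x≤m x≤n)
                             , (λ u ub → ub (m ∧ n) (lower m n))
    ; ↓-linear       = from-yes (all? λ l → all? λ m → all? λ n →
                         (m ≤? l) →-dec (n ≤? l) →-dec ((m ≤? n) ⊎-dec (n ≤? m)))
    }
    where
    greatest : ∀ m n x → x ≤ m → x ≤ n → x ≤ m ∧ n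
    greatest = from-yes (all? λ m → all? λ n → all? λ x →
      (x ≤? m) →-dec (x ≤? n) →-dec (x ≤? m ∧ n))

    lower : ∀ m n → m ∧ n ≤ m × m ∧ n ≤ n
    lower = from-yes (all? λ m → all? λ n → (m ∧ n ≤? m) ×-dec (m ∧ n ≤? n))

  index : Label → Fin 4
  index a = 0F
  index b = 1F
  index c = 2F
  index d = 3F

  label : Fin 4 → Label
  label 0F = a
  label 1F = b
  label 2F = c
  label 3F = d

  label-index : ∀ x → label (index x) ≡ x
  label-index a = refl
  label-index b = refl
  label-index c = refl
  label-index d = refl

  leaf : Label → Fin 7
  leaf x = index x ↑ˡ 3

  _<_ : Rel (Fin 7) 0ℓ
  _<_ = Pseudotree._<_ tree

  C₄ : Label → Label → Label → Set
  C₄ x y z = leaf x ∧ leaf y < leaf y ∧ leaf z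

  isC₄ : IsC₄ C₄
  isC₄ = record
    { isFiniteCRelation =
        (4 , mk↔ₛ′ index label
               (from-yes (all? λ i → index (label i) ≟ i)) label-index) ,
        tree , (7 , ↔-id _) , record
          { leaf           = leaf
          ; leaf-injective = λ {x} {y} eq →
              trans (sym (label-index x))
                (trans (cong label (↑ˡ-injective 3 (index x) (index y) eq))
                       (label-index y))
          ; leaf-maximal   = λ x → from-yes
              (all? λ (i : Fin 4) → all? λ n →
                (i ↑ˡ 3 ≤? n) →-dec (i ↑ˡ 3 ≟ n)) (index x)
          ; C-⇔            = λ _ _ _ → ⇔-id _
          }
    ; a∣cd = refl , λ ()
    ; b∣cd = refl , λ ()
    ; c∣ab = refl , λ ()
    }

module Submission where

-- Enumerate the limit. The records of a node n are the elements x, in order of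
-- the enumeration, for which x ∧ n lies strictly above y ∧ n for all y before x;
-- they form a finite set of indices, and passing to a higher node end-extends
-- it. Colour a copy ab|cd by the number of blocks, modulo the number of colours,
-- into which the records of a ∧ b and those of c ∧ d split one another. In an
-- arbitrary copy of the limit, infinitely many nodes hang off a suitable
-- descending chain, and they add disjoint sets of new records to one common
-- set of records. So above any node one can add new records that are all as
-- large as desired; doing so alternately on the two sides increases the number
-- of blocks one at a time.

open import Defs
open import Data.Bool.Base using (Bool; true; false; not)
import Data.Bool.Properties as Bool
open import Data.Empty using (⊥)
open import Data.Fin.Base using (Fin; zero; suc; toℕ; fromℕ<)
open import Data.Fin.Properties as Fin
  using (inj⇒≟; pigeonhole; toℕ-fromℕ<; toℕ-injective; toℕ<n; 2↔Bool)
open import Data.Maybe.Base as Maybe using (Maybe; just; nothing)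
open import Data.Nat.Base using (ℕ; zero; suc; _+_; _*_; _∸_; _⊔_; _≤_; _<_; z≤n; s≤s)
open import Data.Nat.DivMod using (_mod_; _%_; [m+kn]%n≡m%n; m<n⇒m%n≡m)
open import Data.Nat.Induction using (<-rec)
open import Data.Nat.Properties
open import Data.Product.Base using (_×_; _,_; ∃-syntax; proj₁; proj₂)
open import Data.Sum.Base using (_⊎_; inj₁; inj₂)
open import Function.Base using (_∘_; id)
open import Function.Bundles using (_⇔_; mk⇔; mk↣; Equivalence; Injection; Inverse)
open import Function.Construct.Identity using (↔-id; ⇔-id)
open import Function.Definitions using (Injective)
open import Function.Properties.Equivalence using () renaming (trans to ⇔-trans; sym to ⇔-sym)
open import Function.Properties.Inverse using (↔-sym; ↔⇒↣)
open import Level using (0ℓ) renaming (suc to lsuc)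
open import Relation.Binary.Definitions using (DecidableEquality)
open import Relation.Binary.PropositionalEquality
  using (_≡_; _≢_; refl; sym; trans; cong; cong₂; subst; subst₂; module ≡-Reasoning)
open import Relation.Binary.Structures using (IsPartialOrder)
open import Relation.Nullary using (¬_; Dec; yes; no; does; contradiction; ¬?)
open import Relation.Nullary.Decidable
  using (map′; _×-dec_; _→-dec_; dec-true; dec-false; does-⇔; decidable-stable; from-yes)
open import Relation.Unary using (Pred; _⊆_)

open Equivalence using (to; from)
open IsEmbedding using (injective; C-⇔)
open IsFraïsséLimit

-- Minima and finite quantifiers under double negation

¬¬-minimum : ∀ {ℓ} {A : Set ℓ} (μ : A → ℕ) → A → ¬ ¬ (∃[ x ] ∀ y → μ x ≤ μ y)
¬¬-minimum {A = A} μ x₀ ¬min = <-rec P refute (μ x₀) x₀ refl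
  where
  P : Pred ℕ _
  P n = ∀ x → ¬ (μ x ≡ n)

  refute : ∀ n → (∀ {m} → m < n → P m) → P n
  refute _ below x refl = ¬min (x , λ y → ≮⇒≥ λ y<x → below y<x y refl)

¬¬-∀Fin : ∀ {ℓ n} {P : Fin n → Set ℓ} → (∀ i → ¬ ¬ P i) → ¬ ¬ (∀ i → P i)
¬¬-∀Fin {n = zero}  _    ¬all = ¬all λ ()
¬¬-∀Fin {n = suc _} ¬¬P ¬all = ¬¬P zero λ p₀ →
  ¬¬-∀Fin (λ i → ¬¬P (suc i)) λ ps → ¬all λ { zero → p₀ ; (suc i) → ps i }

-- Oscillation of two sets of natural numbers

-- The state is the side visited last and the number of blocks so far.
State : Set
State = Maybe Bool × ℕ

visit : Bool → State → State
visit s     (nothing    , k) = just s , suc k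
visit true  (just true  , k) = just true , k
visit true  (just false , k) = just true , suc k
visit false (just true  , k) = just false , suc k
visit false (just false , k) = just false , k

-- Common indices are skipped, so the blocks are the maximal one-sided runs of the symmetric
-- difference.
step : Bool → Bool → State → State
step true  false = visit true
step false true  = visit false
step true  true  = λ s → s
step false false = λ s → s

run : (ℕ → Bool) → (ℕ → Bool) → ℕ → State
run f g zero    = nothing , 0
run f g (suc n) = step (f n) (g n) (run f g n)

blocks : (ℕ → Bool) → (ℕ → Bool) → ℕ → ℕ
blocks f g n = proj₂ (run f g n)

mirror : State → State
mirror (l , k) = Maybe.map not l , k

step-mirror : ∀ x y s → step y x (mirror s) ≡ mirror (step x y s)
step-mirror true  true  s = refl
step-mirror false false s = refl
step-mirror true  false (nothing    , k) = refl
step-mirror true  false (just true  , k) = refl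
step-mirror true  false (just false , k) = refl
step-mirror false true  (nothing    , k) = refl
step-mirror false true  (just true  , k) = refl
step-mirror false true  (just false , k) = refl

run-mirror : ∀ f g n → run g f n ≡ mirror (run f g n)
run-mirror f g zero    = refl
run-mirror f g (suc n) =
  trans (cong (step (g n) (f n)) (run-mirror f g n)) (step-mirror (f n) (g n) (run f g n))

infix 4 _≈[_]_ _⊑_

_≈[_]_ : (ℕ → Bool) → ℕ → (ℕ → Bool) → Set
f ≈[ N ] g = ∀ n → n < N → f n ≡ g n

-- f is an initial segment of g.
_⊑_ : (ℕ → Bool) → (ℕ → Bool) → Set
f ⊑ g = ∀ j → f j ≡ true → ∀ n → n ≤ j → f n ≡ g n

VanishesFrom : ℕ → Pred (ℕ → Bool) 0ℓ
VanishesFrom N f = ∀ n → N ≤ n → f n ≡ false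

vanishesFrom-mono : ∀ {M N f} → M ≤ N → VanishesFrom M f → VanishesFrom N f
vanishesFrom-mono M≤N f≡0 n N≤n = f≡0 n (≤-trans M≤N N≤n)

run-cong : ∀ {f f′ g g′} N → f ≈[ N ] f′ → g ≈[ N ] g′ → run f g N ≡ run f′ g′ N
run-cong zero    f≈f′ g≈g′ = refl
run-cong {f} {f′} {g} {g′} (suc N) f≈f′ g≈g′
  rewrite f≈f′ N ≤-refl | g≈g′ N ≤-refl =
  cong (step (f′ N) (g′ N))
    (run-cong N (λ n n<N → f≈f′ n (m<n⇒m<1+n n<N)) (λ n n<N → g≈g′ n (m<n⇒m<1+n n<N)))

run-stable : ∀ {f g N} → VanishesFrom N f → VanishesFrom N g →
             ∀ e → run f g (e + N) ≡ run f g N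
run-stable f≡0 g≡0 zero = refl
run-stable {N = N} f≡0 g≡0 (suc e)
  rewrite f≡0 (e + N) (m≤n+m N e) | g≡0 (e + N) (m≤n+m N e) = run-stable f≡0 g≡0 e

blocks-stable : ∀ {f g M N} → VanishesFrom M f → VanishesFrom M g → M ≤ N →
                blocks f g N ≡ blocks f g M
blocks-stable {f} {g} {M} {N} f≡0 g≡0 M≤N =
  trans (cong (blocks f g) (sym (m∸n+n≡m M≤N))) (cong proj₂ (run-stable f≡0 g≡0 (N ∸ M)))

visit-idem : ∀ b s → visit b (visit b s) ≡ visit b s
visit-idem true  (nothing    , k) = refl
visit-idem true  (just true  , k) = refl
visit-idem true  (just false , k) = refl
visit-idem false (nothing    , k) = refl
visit-idem false (just true  , k) = refl
visit-idem false (just false , k) = refl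

visit-step : ∀ b s → visit true (step b false s) ≡ visit true s
visit-step true  s = visit-idem true s
visit-step false s = refl

-- While g vanishes, f contributes at most one new block.
visit-run : ∀ {f g N} → VanishesFrom N g →
            ∀ e → visit true (run f g (e + N)) ≡ visit true (run f g N)
visit-run g≡0 zero = refl
visit-run {f} {g} {N} g≡0 (suc e) rewrite g≡0 (e + N) (m≤n+m N e) =
  trans (visit-step (f (e + N)) (run f g (e + N))) (visit-run g≡0 e)

run-fixed : ∀ {f g N} → VanishesFrom N g → visit true (run f g N) ≡ run f g N →
            ∀ e → run f g (e + N) ≡ run f g N
run-fixed g≡0 fix zero = refl
run-fixed {f} {g} {N} g≡0 fix (suc e)
  rewrite g≡0 (e + N) (m≤n+m N e) | run-fixed {f} g≡0 fix e with f (e + N)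
... | true  = fix
... | false = refl

-- From `N` on, `g` is empty, so all members of `f′` there form a single block, which merges with
-- the last one if that already lay on the side `true`. The outcome does not depend on how many
-- members there are beyond `j`.
run-advance : ∀ {f f′ g N j M} → VanishesFrom N g → f ≈[ N ] f′ →
              N ≤ j → f′ j ≡ true → j < M →
              run f′ g M ≡ visit true (run f g N)
run-advance {f} {f′} {g} {N} {j} {M} g≡0 f≈f′ N≤j f′j j<M = begin
  run f′ g M                     ≡⟨ cong (run f′ g) (m∸n+n≡m j<M) ⟨
  run f′ g ((M ∸ suc j) + suc j) ≡⟨ run-fixed g≡0′ fix (M ∸ suc j) ⟩
  run f′ g (suc j)               ≡⟨ at-j ⟩
  visit true (run f g N)         ∎
  where
  open ≡-Reasoning

  g≡0′ : VanishesFrom (suc j) g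
  g≡0′ = vanishesFrom-mono (m≤n⇒m≤1+n N≤j) g≡0

  at-j : run f′ g (suc j) ≡ visit true (run f g N)
  at-j = begin
    step (f′ j) (g j) (run f′ g j)
      ≡⟨ cong₂ (λ x y → step x y (run f′ g j)) f′j (g≡0 j N≤j) ⟩
    visit true (run f′ g j)
      ≡⟨ cong (λ n → visit true (run f′ g n)) (m∸n+n≡m N≤j) ⟨
    visit true (run f′ g ((j ∸ N) + N))
      ≡⟨ visit-run g≡0 (j ∸ N) ⟩
    visit true (run f′ g N)
      ≡⟨ cong (visit true) (run-cong N (λ n n<N → sym (f≈f′ n n<N)) (λ _ _ → refl)) ⟩
    visit true (run f g N) ∎

  fix : visit true (run f′ g (suc j)) ≡ run f′ g (suc j)
  fix = trans (cong (visit true) at-j) (trans (visit-idem true (run f g N)) (sym at-j))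

-- t need not belong to ℱ.
record Splits (ℱ : Pred (ℕ → Bool) 0ℓ) (t : ℕ → Bool) : Set where
  field
    bound  : ∃[ N ] VanishesFrom N t
    extend : ∀ N → ¬ ¬ (∃[ f ] (ℱ f × t ≈[ N ] f × ∃[ j ] (N ≤ j × f j ≡ true)))

-- The analogue of a superperfect tree for finite sets under end-extension: every member extends to
-- a set that has arbitrarily late continuations in the family.
record Branching (ℱ : Pred (ℕ → Bool) 0ℓ) : Set where
  field
    member  : ∃[ f ] ℱ f
    bounded : ∀ f → ℱ f → ∃[ N ] VanishesFrom N f
    split   : ∀ f → ℱ f → ¬ ¬ (∃[ t ] (Splits ℱ t × f ⊑ t))

Oscillation : (ℕ → Bool) → (ℕ → Bool) → ℕ → Set
Oscillation f g k = ∃[ N ] ∀ M → N ≤ M → blocks f g M ≡ k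

oscillation-sym : ∀ {f g k} → Oscillation f g k → Oscillation g f k
oscillation-sym {f} {g} (N , osc) =
  N , λ M N≤M → trans (cong proj₂ (run-mirror f g M)) (osc M N≤M)

Reaches : Pred (ℕ → Bool) 0ℓ → Pred (ℕ → Bool) 0ℓ → State → Set
Reaches ℱ 𝒢 s =
  ∃[ t ] ∃[ u ] ∃[ N ] (Splits ℱ t × Splits 𝒢 u × VanishesFrom N t × VanishesFrom N u ×
                        run t u N ≡ s)

module _ {ℱ 𝒢 : Pred (ℕ → Bool) 0ℓ} where
  open Splits
  open Branching

  reaches-start : Branching ℱ → Branching 𝒢 → ¬ ¬ (∃[ s ] Reaches ℱ 𝒢 s)
  reaches-start F G k =
    split F _ (member F .proj₂) λ (t , St , _) →
    split G _ (member G .proj₂) λ (u , Su , _) →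
    let (M , t≡0) = bound St
        (N , u≡0) = bound Su
    in k (_ , t , u , M ⊔ N , St , Su ,
          vanishesFrom-mono (m≤m⊔n M N) t≡0 , vanishesFrom-mono (m≤n⊔m M N) u≡0 , refl)

  -- A member `f` continues `t` past `N`, and a splitting set `t′` continues `f`. However many
  -- elements they add, these lie beyond all of `u` and make at most one new block. Mirroring hands
  -- the next move to the other side.
  reaches-next : ∀ {s} → Branching ℱ → Reaches ℱ 𝒢 s → ¬ ¬ Reaches 𝒢 ℱ (mirror (visit true s))
  reaches-next F (t , u , N , St , Su , t≡0 , u≡0 , refl) k =
    extend St N λ (f , f∈ℱ , t≈f , j , N≤j , fj) →
    split F f f∈ℱ λ (t′ , St′ , f⊑t′) →
    let (K , t′≡0) = bound St′
        M          = suc j ⊔ K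
        N≤M        = ≤-trans N≤j (≤-trans (n≤1+n j) (m≤m⊔n (suc j) K))
        t≈t′       = λ n n<N → trans (t≈f n n<N) (f⊑t′ j fj n (≤-trans (<⇒≤ n<N) N≤j))
        t′j        = trans (sym (f⊑t′ j fj j ≤-refl)) fj
    in k (u , t′ , M , Su , St′ ,
          vanishesFrom-mono N≤M u≡0 , vanishesFrom-mono (m≤n⊔m (suc j) K) t′≡0 ,
          trans (run-mirror t′ u M)
                (cong mirror (run-advance {f = t} {t′} u≡0 t≈t′ N≤j t′j (m≤m⊔n (suc j) K))))

  -- Splitting sets may lie outside the families, so each is finally replaced by a member continuing
  -- it: first `t` by `f`, then `u` by a `g` whose new elements come after all of `f`. Each
  -- replacement adds one block, hence `2 + m`.
  reaches-realised : ∀ {m} → Branching ℱ → Reaches ℱ 𝒢 (just false , m) →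
                     ¬ ¬ (∃[ f ] ∃[ g ] (ℱ f × 𝒢 g × Oscillation f g (2 + m)))
  reaches-realised F (t , u , N , St , Su , t≡0 , u≡0 , at-N) k =
    extend St N λ (f , f∈ℱ , t≈f , j , N≤j , fj) →
    let (K , f≡0) = bounded F f f∈ℱ
        M         = suc j ⊔ K
        f≡0′      = vanishesFrom-mono (m≤n⊔m (suc j) K) f≡0
        at-M      = trans (run-advance {f = t} u≡0 t≈f N≤j fj (m≤m⊔n (suc j) K))
                          (cong (visit true) at-N)
    in
    extend Su M λ (g , g∈𝒢 , u≈g , i , M≤i , gi) →
    k (f , g , f∈ℱ , g∈𝒢 , oscillation-sym (suc i , λ L i<L → cong proj₂
      (trans (run-advance {f = u} f≡0′ u≈g M≤i gi i<L)
             (cong (visit true) (trans (run-mirror f u M) (cong mirror at-M))))))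

Oscillates : Pred (ℕ → Bool) 0ℓ → Pred (ℕ → Bool) 0ℓ → ℕ → Set
Oscillates ℱ 𝒢 k = ∃[ f ] ∃[ g ] (ℱ f × 𝒢 g × Oscillation f g k)

-- When the last side is `false`, a move adds exactly one block and, after mirroring, leaves `false`
-- last again. The families exchange roles at each move.
reaches-all : ∀ {ℱ 𝒢 m} → Branching ℱ → Branching 𝒢 → Reaches ℱ 𝒢 (just false , m) →
              ∀ k → ¬ ¬ Oscillates ℱ 𝒢 (2 + (k + m))
reaches-all F G r zero    ¬osc = reaches-realised F r ¬osc
reaches-all {m = m} F G r (suc k) ¬osc =
  reaches-next F r λ r′ →
  reaches-all G F r′ k λ (f , g , f∈ , g∈ , osc) →
  ¬osc (g , f , g∈ , f∈ , subst (λ n → Oscillation g f (2 + n)) (+-suc k m) (oscillation-sym osc))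

oscillates-cofinitely : ∀ {ℱ 𝒢} → Branching ℱ → Branching 𝒢 →
                        ¬ ¬ (∃[ m ] ∀ k → ¬ ¬ Oscillates ℱ 𝒢 (k + m))
oscillates-cofinitely {ℱ} {𝒢} F G ¬cof =
  reaches-start F G λ (s , r) →
  -- One preliminary move makes `false` the last side, whatever the initial state was.
  reaches-next F r λ r′ →
  let (m , eq) = last-false s
      r″       = subst (Reaches 𝒢 ℱ) eq r′
  in ¬cof (2 + m , λ k ¬osc →
       reaches-all G F r″ k λ (f , g , f∈ , g∈ , osc) →
       ¬osc (g , f , g∈ , f∈ , subst (Oscillation g f) (shift k m) (oscillation-sym osc)))
  where
  last-false : ∀ s → ∃[ m ] mirror (visit true s) ≡ (just false , m)
  last-false (nothing    , k) = suc k , refl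
  last-false (just true  , k) = k , refl
  last-false (just false , k) = suc k , refl

  shift : ∀ k m → 2 + (k + m) ≡ k + (2 + m)
  shift k m = trans (cong suc (sym (+-suc k m))) (sym (+-suc k (suc m)))

-- C-relations as trees of leaves

-- The axioms of a C-relation without reference to a tree, together with decidability. `C A x y z`
-- reads: the leaf `x` is not above the node `y ∧ z`.
record IsCSpace (A : Structure) : Set where
  field
    C?       : ∀ x y z → Dec (C A x y z)
    C-sym    : ∀ {x y z} → C A x y z → C A x z y
    C-asym   : ∀ {x y z} → C A x y z → ¬ C A y x z
    C-branch : ∀ {x y z} w → C A x y z → C A x y w ⊎ C A w y z
    C-diag   : ∀ {x y} → x ≢ y → C A x y y

module PseudotreeProperties (T : Pseudotree) (finite : Finite (Pseudotree.Node T)) where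
  open Pseudotree T renaming (_≤_ to _≤ᵀ_; _<_ to _<ᵀ_)
  open IsPartialOrder isPartialOrder public
    using () renaming (refl to ≤ᵀ-refl; trans to ≤ᵀ-trans; antisym to ≤ᵀ-antisym)

  ∧-lowerˡ : ∀ m n → m ∧ n ≤ᵀ m
  ∧-lowerˡ m n = ∧-sup m n .proj₂ m λ _ → proj₁

  ∧-lowerʳ : ∀ m n → m ∧ n ≤ᵀ n
  ∧-lowerʳ m n = ∧-sup m n .proj₂ n λ _ → proj₂

  ∧-greatest : ∀ {l m n} → l ≤ᵀ m → l ≤ᵀ n → l ≤ᵀ m ∧ n
  ∧-greatest l≤m l≤n = ∧-sup _ _ .proj₁ _ (l≤m , l≤n)

  ∧-swap : ∀ m n → m ∧ n ≤ᵀ n ∧ m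
  ∧-swap m n = ∧-greatest (∧-lowerʳ m n) (∧-lowerˡ m n)

  infix 4 _≤ᵀ?_

  _≤ᵀ?_ : ∀ m n → Dec (m ≤ᵀ n)
  m ≤ᵀ? n = map′ (λ eq → subst (_≤ᵀ n) eq (∧-lowerʳ m n))
                 (λ m≤n → ≤ᵀ-antisym (∧-lowerˡ m n) (∧-greatest ≤ᵀ-refl m≤n))
                 (inj⇒≟ (↔⇒↣ (finite .proj₂)) (m ∧ n) m)

  -- Both meets lie below `m` and are therefore comparable, so strictness fails only when `m ∧ n` is
  -- below `l`.
  C⇔≰ : ∀ {l m n} → (l ∧ m <ᵀ m ∧ n) ⇔ (¬ m ∧ n ≤ᵀ l)
  C⇔≰ {l} {m} {n} = mk⇔
    (λ (le , ne) ≤l → ne (≤ᵀ-antisym le (∧-greatest ≤l (∧-lowerˡ m n))))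
    (λ ≰l → lt ≰l (↓-linear m (l ∧ m) (m ∧ n) (∧-lowerʳ l m) (∧-lowerˡ m n)))
    where
    lt : ¬ m ∧ n ≤ᵀ l → l ∧ m ≤ᵀ m ∧ n ⊎ m ∧ n ≤ᵀ l ∧ m → l ∧ m <ᵀ m ∧ n
    lt ≰l (inj₁ le) = le , λ eq → ≰l (subst (_≤ᵀ l) eq (∧-lowerˡ l m))
    lt ≰l (inj₂ ge) = contradiction (≤ᵀ-trans ge (∧-lowerˡ l m)) ≰l

isFiniteCRelation⇒isCSpace : ∀ {A} → IsFiniteCRelation A → IsCSpace A
isFiniteCRelation⇒isCSpace {A} (_ , T , finite , rel) = record
  { C?       = λ x y z → map′ ≰⇒C C⇒≰ (¬? (leaf y ∧ leaf z ≤ᵀ? leaf x))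
  ; C-sym    = λ {x} {y} {z} p → ≰⇒C (C⇒≰ p ∘ ≤ᵀ-trans (∧-swap (leaf y) (leaf z)))
  ; C-asym   = λ {x} {y} {z} p q → asym (C⇒≰ p) (C⇒≰ q)
      (↓-linear (leaf z) (leaf x ∧ leaf z) (leaf y ∧ leaf z)
        (∧-lowerʳ (leaf x) (leaf z)) (∧-lowerʳ (leaf y) (leaf z)))
  ; C-branch = λ {x} {y} {z} w p → branch p (leaf y ∧ leaf z ≤ᵀ? leaf w)
  ; C-diag   = λ {x} {y} x≢y → ≰⇒C λ ≤x → x≢y (sym (leaf-injective
      (leaf-maximal y (leaf x) (≤ᵀ-trans (∧-greatest ≤ᵀ-refl ≤ᵀ-refl) ≤x))))
  }
  where
  open Pseudotree T using (_∧_; ↓-linear) renaming (_≤_ to _≤ᵀ_)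
  open PseudotreeProperties T finite
  open IsCRelationOf rel renaming (C-⇔ to C⇔<)

  C⇒≰ : ∀ {x y z} → C A x y z → ¬ leaf y ∧ leaf z ≤ᵀ leaf x
  C⇒≰ p = C⇔≰ .to (C⇔< _ _ _ .to p)

  ≰⇒C : ∀ {x y z} → ¬ leaf y ∧ leaf z ≤ᵀ leaf x → C A x y z
  ≰⇒C p = C⇔< _ _ _ .from (C⇔≰ .from p)

  asym : ∀ {l m n} → ¬ m ∧ n ≤ᵀ l → ¬ l ∧ n ≤ᵀ m →
         ¬ (l ∧ n ≤ᵀ m ∧ n ⊎ m ∧ n ≤ᵀ l ∧ n)
  asym {l} {m} {n} p q (inj₁ le) = q (≤ᵀ-trans le (∧-lowerˡ m n))
  asym {l} {m} {n} p q (inj₂ ge) = p (≤ᵀ-trans ge (∧-lowerˡ l n))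

  branch : ∀ {x y z w} → C A x y z → Dec (leaf y ∧ leaf z ≤ᵀ leaf w) → C A x y w ⊎ C A w y z
  branch {y = y} {z} p (yes ≤w) = inj₁ (≰⇒C λ ≤x →
    C⇒≰ p (≤ᵀ-trans (∧-greatest (∧-lowerˡ (leaf y) (leaf z)) ≤w) ≤x))
  branch p (no ≰w) = inj₂ (≰⇒C ≰w)

module CSpaceProperties {A : Structure} (S : IsCSpace A) where
  open IsCSpace S public

  private
    variable
      u x x′ y y′ z w : Carrier A

  C-irrefl : ¬ C A x x y
  C-irrefl p = C-asym p p

  C⇒≢ : C A x y z → x ≢ y
  C⇒≢ p refl = C-irrefl p

  C-trans : C A u x y → C A u y z → C A u x z
  C-trans {u} {x} {y} {z} p q with C-branch z p
  ... | inj₁ r = r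
  ... | inj₂ r with C-branch x (C-sym q)
  ...   | inj₁ s = C-sym s
  ...   | inj₂ s = contradiction s (C-asym r)

  -- For nodes on the path to `x` this is `x ∧ y < x ∧ z < x ∧ w`.
  C-chain : C A y x z → C A z x w → C A y x w
  C-chain {w = w} p q with C-branch w p
  ... | inj₁ r = r
  ... | inj₂ r = contradiction (C-sym r) (C-asym (C-sym q))

  -- A pair x, y stands for the node x ∧ y, and C u x y says that u is not above it.
  Below : (x y x′ y′ : Carrier A) → Set
  Below x y x′ y′ = ∀ {u} → C A u x y → C A u x′ y′

  below-cone : C A y x z → Below x y x z
  below-cone {y} {x} {z} p {u} q with C-branch z q
  ... | inj₁ r = r
  ... | inj₂ r = contradiction (C-sym p) (C-asym (C-sym r))

  -- `x′` lies above `x ∧ y`, since otherwise `below` would separate `x′` from its own node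
  -- `x′ ∧ y′`.
  C-link : Below x y x′ y′ → C A u x y → C A u x x′
  C-link {x′ = x′} below p with C-branch x′ p
  ... | inj₁ q = q
  ... | inj₂ q = contradiction (below q) C-irrefl

  -- The nodes `x ∧ y` and `z ∧ w` are incomparable; one leaf of each pair is enough to express
  -- this.
  record Crossing (x y z w : Carrier A) : Set where
    field
      x≢y  : x ≢ y
      z≢w  : z ≢ w
      x∣zw : C A x z w
      z∣xy : C A z x y

    y∣zw : C A y z w
    y∣zw with C-branch y x∣zw
    ... | inj₁ p = contradiction p (C-asym z∣xy)
    ... | inj₂ p = p

    w∣xy : C A w x y
    w∣xy with C-branch w z∣xy
    ... | inj₁ p = contradiction p (C-asym x∣zw)
    ... | inj₂ p = p

  crossing-above : ∀ {x y z w x′ y′ z′ w′} → Crossing x y z w →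
                   Below x y x′ y′ → Below z w z′ w′ → x′ ≢ y′ → z′ ≢ w′ →
                   Crossing x′ y′ z′ w′
  crossing-above X below₁ below₂ x′≢y′ z′≢w′ = record
    { x≢y = x′≢y′ ; z≢w = z′≢w′
    ; x∣zw = below₂ (apart below₁ z∣xy x∣zw) ; z∣xy = below₁ (apart below₂ x∣zw z∣xy)
    }
    where
    open Crossing X

    apart : ∀ {x y z w x′ y′} → Below x y x′ y′ → C A z x y → C A x z w → C A x′ z w
    apart {x′ = x′} below p q with C-branch x′ q | C-branch x′ p
    ... | inj₂ r | _      = r
    ... | inj₁ r | inj₁ s = contradiction r (C-asym s)
    ... | inj₁ _ | inj₂ s = contradiction (below s) C-irrefl

-- Quadruples of leaves spanning the tree ab|cd

side : Label → Bool
side a = true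
side b = true
side c = false
side d = false

partner : Label → Label
partner a = b
partner b = a
partner c = d
partner d = c

same-side⇒partner : ∀ {l m} → l ≢ m → side l ≡ side m → m ≡ partner l
same-side⇒partner {a} {a} l≢m _ = contradiction refl l≢m
same-side⇒partner {a} {b} _   _ = refl
same-side⇒partner {b} {a} _   _ = refl
same-side⇒partner {b} {b} l≢m _ = contradiction refl l≢m
same-side⇒partner {c} {c} l≢m _ = contradiction refl l≢m
same-side⇒partner {c} {d} _   _ = refl
same-side⇒partner {d} {c} _   _ = refl
same-side⇒partner {d} {d} l≢m _ = contradiction refl l≢m

_≟ᴸ_ : DecidableEquality Label
_≟ᴸ_ = inj⇒≟ (mk↣ {to = C₄-Exists.index} λ {l} {m} eq →
  trans (sym (C₄-Exists.label-index l))
    (trans (cong C₄-Exists.label eq) (C₄-Exists.label-index m)))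

quadruple : {X : Set} → X → X → X → X → Label → X
quadruple x y z w a = x
quadruple x y z w b = y
quadruple x y z w c = z
quadruple x y z w d = w

-- The C-relation of the tree ab|cd.
Split : Label → Label → Label → Set
Split l m n = l ≢ m × l ≢ n × side m ≡ side n

module _ {A : Structure} (S : IsCSpace A) {x y z w : Carrier A} where
  open CSpaceProperties S

  module _ (X : Crossing x y z w) where
    open Crossing X

    private
      h : Label → Carrier A
      h = quadruple x y z w

    mates-distinct : ∀ l → h l ≢ h (partner l)
    mates-distinct a = x≢y
    mates-distinct b = x≢y ∘ sym
    mates-distinct c = z≢w
    mates-distinct d = z≢w ∘ sym

    sides-split : ∀ {l m} → side l ≢ side m → C A (h l) (h m) (h (partner m))
    sides-split {a} {a} ne = contradiction refl ne
    sides-split {a} {b} ne = contradiction refl ne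
    sides-split {a} {c} _ = x∣zw
    sides-split {a} {d} _ = C-sym x∣zw
    sides-split {b} {a} ne = contradiction refl ne
    sides-split {b} {b} ne = contradiction refl ne
    sides-split {b} {c} _ = y∣zw
    sides-split {b} {d} _ = C-sym y∣zw
    sides-split {c} {a} _ = z∣xy
    sides-split {c} {b} _ = C-sym z∣xy
    sides-split {c} {c} ne = contradiction refl ne
    sides-split {c} {d} ne = contradiction refl ne
    sides-split {d} {a} _ = w∣xy
    sides-split {d} {b} _ = C-sym w∣xy
    sides-split {d} {c} ne = contradiction refl ne
    sides-split {d} {d} ne = contradiction refl ne

    quadruple-distinct : ∀ {l m} → l ≢ m → h l ≢ h m
    quadruple-distinct {l} {m} l≢m with side l Bool.≟ side m
    ... | no  ne = C⇒≢ (sides-split ne)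
    ... | yes eq rewrite same-side⇒partner l≢m eq = mates-distinct l

    quadruple-injective : Injective _≡_ _≡_ h
    quadruple-injective {l} {m} eq = decidable-stable (l ≟ᴸ m) λ l≢m → quadruple-distinct l≢m eq

    C⇒same-side : ∀ {l m n} → C A (h l) (h m) (h n) → side m ≡ side n
    C⇒same-side {l} {m} {n} p with side l Bool.≟ side m | side l Bool.≟ side n
    ... | no  m≢ | no  n≢ = trans (Bool.¬-not (m≢ ∘ sym)) (sym (Bool.¬-not (n≢ ∘ sym)))
    ... | yes l≡m | yes l≡n = trans (sym l≡m) l≡n
    ... | yes l≡m | no n≢ = contradiction (sides-split (n≢ ∘ sym))
      (C-asym (C-sym (subst (λ k → C A (h l) (h k) (h n))
        (same-side⇒partner (C⇒≢ p ∘ cong h) l≡m) p)))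
    ... | no m≢ | yes l≡n = contradiction (sides-split (m≢ ∘ sym))
      (C-asym (subst (λ k → C A (h l) (h m) (h k))
        (same-side⇒partner (C⇒≢ (C-sym p) ∘ cong h) l≡n) p))

    -- A crossing forces every instance of `C` on its four leaves. This yields both the uniqueness
    -- of the structure on the labels and the fact that each crossing spans a copy of it.
    C⇔Split : ∀ l m n → C A (h l) (h m) (h n) ⇔ Split l m n
    C⇔Split l m n = mk⇔
      (λ p → C⇒≢ p ∘ cong h , C⇒≢ (C-sym p) ∘ cong h , C⇒same-side {l} p)
      λ (l≢m , l≢n , eq) → split l≢m l≢n eq
      where
      split : ∀ {l m n} → l ≢ m → l ≢ n → side m ≡ side n → C A (h l) (h m) (h n)
      split {l} {m} {n} l≢m l≢n m≡n with m ≟ᴸ n | side l Bool.≟ side m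
      ... | yes refl | _       = C-diag (quadruple-distinct l≢m)
      ... | no  m≢n  | no  ne  rewrite same-side⇒partner m≢n m≡n = sides-split ne
      ... | no  m≢n  | yes l≡m = contradiction
        (trans (same-side⇒partner l≢m l≡m) (sym (same-side⇒partner l≢n (trans l≡m m≡n)))) m≢n

-- Records

record Enumeration (X : Set) : Set where
  field
    index           : X → ℕ
    index-injective : Injective _≡_ _≡_ index
    find            : ∀ n → Dec (∃[ x ] index x ≡ n)

module Records {A : Structure} (S : IsCSpace A) (E : Enumeration (Carrier A)) where
  open CSpaceProperties S
  open Enumeration E

  private
    variable
      x x′ y y′ z : Carrier A

  -- In the order of the enumeration, z climbs higher along the path to the
  -- node x ∧ y than every earlier element.
  Record : (x y z : Carrier A) → Set
  Record x y z = ∀ u → index u < index z → C A u x y × C A u x z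

  RecordAt : (x y : Carrier A) → ℕ → Set
  RecordAt x y n = ∃[ z ] (index z ≡ n × Record x y z)

  Record? : ∀ x y z → Dec (Record x y z)
  Record? x y z = map′ (λ below u u<z → below u<z u refl) (λ { rec lt u refl → rec u lt })
    (allUpTo? at? (index z))
    where
    at? : ∀ n → Dec (∀ u → index u ≡ n → C A u x y × C A u x z)
    at? n with find n
    ... | no  none       = yes λ u eq → contradiction (u , eq) none
    ... | yes (v , refl) = map′
      (λ p u eq → subst (λ w → C A w x y × C A w x z) (sym (index-injective eq)) p)
      (λ p → p v refl)
      (C? v x y ×-dec C? v x z)

  RecordAt? : ∀ x y n → Dec (RecordAt x y n)
  RecordAt? x y n with find n
  ... | no  none       = no λ (z , eq , _) → none (z , eq)
  ... | yes (z , refl) = map′ (λ r → z , refl , r)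
    (λ (z′ , eq , r) → subst (Record x y) (index-injective eq) r) (Record? x y z)

  rec : Carrier A → Carrier A → ℕ → Bool
  rec x y n = does (RecordAt? x y n)

  recordAt : ∀ {n} → rec x y n ≡ true → RecordAt x y n
  recordAt {x} {y} {n} eq with RecordAt? x y n | eq
  ... | yes r | _ = r

  rec-true : Record x y z → rec x y (index z) ≡ true
  rec-true {x} {y} {z} r = dec-true (RecordAt? x y (index z)) (z , refl , r)

  -- `Record` follows the path to `x`, but it only looks below `x ∧ y`, where the paths to `x` and
  -- to `y` coincide.
  rec-swap : ∀ x y n → rec x y n ≡ rec y x n
  rec-swap x y n = does-⇔ (mk⇔ swap swap) (RecordAt? x y n) (RecordAt? y x n)
    where
    swap : ∀ {x y} → RecordAt x y n → RecordAt y x n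
    swap (z , eq , r) = z , eq , λ u u<z → let (p , q) = r u u<z in
      C-sym p , C-trans (C-sym p) q

  -- Once `z` is above the node, no later element can climb higher on the path to it.
  rec-vanishes : ¬ C A z x y → VanishesFrom (suc (index z)) (rec x y)
  rec-vanishes {z} {x} {y} z∈ n z<n = dec-false (RecordAt? x y n)
    λ { (_ , refl , r) → z∈ (r z z<n .proj₁) }

  first-above⇒record : ¬ C A z x y → (∀ u → index u < index z → C A u x y) → Record x y z
  first-above⇒record {z} {x} {y} z∈ first u u<z = first u u<z , link (C-branch z (first u u<z))
    where
    link : C A u x z ⊎ C A z x y → C A u x z
    link (inj₁ p) = p
    link (inj₂ p) = contradiction p z∈

  -- Elements enumerated before a record of the lower node branch off below that node, where the
  -- paths to the two nodes coincide.
  below⇒⊑ : Below x′ y′ x y → rec x′ y′ ⊑ rec x y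
  below⇒⊑ {x′} {y′} {x} {y} below j rj n n≤j with recordAt {x′} {y′} rj
  ... | t , refl , rt = does-⇔ (mk⇔ up down) (RecordAt? x′ y′ n) (RecordAt? x y n)
    where
    link : ∀ {u} → C A u x′ y′ → C A u x′ x
    link = C-link below

    up : RecordAt x′ y′ n → RecordAt x y n
    up (z , eq , r) = z , eq , λ u u<z → let (p , q) = r u u<z in
      below p , C-trans (C-sym (link p)) q

    down : RecordAt x y n → RecordAt x′ y′ n
    down (z , refl , r) = z , refl , λ u u<z → let (_ , q) = r u u<z
                                                   (p , _) = rt u (<-≤-trans u<z n≤j) in
      p , C-trans (link p) q

  -- What is used of a copy of the limit: inside `D`, the nodes on the path to a leaf have no
  -- highest one, and they are densely ordered.
  record IsRich (D : Pred (Carrier A) 0ℓ) : Set where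
    field
      extend  : ∀ {x y} → D x → D y → x ≢ y → ∃[ v ] (D v × v ≢ x × C A y x v)
      between : ∀ {x y v} → D x → D y → D v → v ≢ x → C A y x v →
                ∃[ w ] (D w × C A w x v × C A y x w)

  module _ {D : Pred (Carrier A) 0ℓ} (R : IsRich D) where
    open IsRich R

    Nodes : (p q : Carrier A) → Pred (ℕ → Bool) 0ℓ
    Nodes p q f = ∃[ x ] ∃[ y ] (D x × D y × x ≢ y × Below p q x y × f ≡ rec x y)

    module _ {p q x y} (Dx : D x) (Dy : D y) (pq≤xy : Below p q x y) where

      -- The nodes x ∧ v above x ∧ y.
      Upper : Set
      Upper = ∃[ v ] (D v × v ≢ x × C A y x v)

      lower : (v : Upper) → ∃[ w ] (D w × w ≢ x × C A w x (v .proj₁) × C A y x w)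
      lower (v , Dv , v≢x , p) =
        let (w , Dw , q , r) = between Dx Dy Dv v≢x p in w , Dw , C⇒≢ q , q , r

      -- z also lies above every node below x ∧ v₀, so by minimality it is the
      -- last record of all the nodes of the chain. The records of twigs growing
      -- out of the chain continue those of x ∧ v₀, in pairwise disjoint ways
      -- for different twigs, so some continuation starts arbitrarily late.
      module _ (v₀ : Upper) (z : Carrier A) (z∈ : ¬ C A z x (v₀ .proj₁))
               (z-min : (v : Upper) → ∀ u → ¬ C A u x (v .proj₁) → index z ≤ index u) where

        chain : ℕ → Upper
        chain zero    = v₀
        chain (suc i) = let (w , Dw , w≢x , _ , q) = lower (chain i) in w , Dw , w≢x , q

        node : ℕ → Carrier A
        node i = chain i .proj₁

        chain-step : ∀ i → C A (node (suc i)) x (node i)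
        chain-step i = lower (chain i) .proj₂ .proj₂ .proj₂ .proj₁

        chain-desc : ∀ {i j} → i < j → C A (node j) x (node i)
        chain-desc {i} {suc j} (s≤s i≤j) with m≤n⇒m<n∨m≡n i≤j
        ... | inj₁ i<j  = C-chain (chain-step j) (chain-desc i<j)
        ... | inj₂ refl = chain-step j

        below-v₀ : ∀ i → C A (node (suc i)) x (node 0)
        below-v₀ i = chain-desc (s≤s (z≤n {i}))

        apart : ∀ i → C A (node (suc i)) x z
        apart i with C-branch z (below-v₀ i)
        ... | inj₁ p = p
        ... | inj₂ p = contradiction p z∈

        first : ∀ i u → index u < index z → C A u x (node i)
        first i u u<z = decidable-stable (C? u x (node i)) λ u∈ →
          <⇒≱ u<z (z-min (chain i) u u∈)

        twig : ∀ i → ∃[ w ] (D w × w ≢ node i × C A x (node i) w)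
        twig i = let (_ , Dv , v≢x , _) = chain i in extend Dv Dx v≢x

        module _ (i : ℕ) where
          v w : Carrier A
          v = node (suc i)
          w = twig (suc i) .proj₁

          p∣vw : C A x v w
          p∣vw = twig (suc i) .proj₂ .proj₂ .proj₂

          xv≤xv₀ : Below x v x (node 0)
          xv≤xv₀ = below-cone (below-v₀ i)

          xv≤vw : Below x v v w
          xv≤vw = below-cone p∣vw ∘ C-sym

          z-record : Record x v z
          z-record = first-above⇒record (z∈ ∘ xv≤xv₀) (first (suc i))

          z∉vw : C A z v w
          z∉vw with C-branch z p∣vw
          ... | inj₁ p = contradiction p (C-asym (apart i))
          ... | inj₂ p = p

          -- The node `x ∧ v` lies below both nodes and has the record `z`, so both record sets
          -- coincide with its own up to `z`.
          agree : ∀ n → n ≤ index z → rec x (node 0) n ≡ rec v w n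
          agree n n≤z = trans (sym (below⇒⊑ xv≤xv₀ _ (rec-true z-record) n n≤z))
                              (below⇒⊑ xv≤vw _ (rec-true z-record) n n≤z)

          -- The first leaf above `v ∧ w` is such a record: nothing before `z` lies above even
          -- `x ∧ v`, and `z` itself is not above `v ∧ w`.
          later : ¬ ¬ (∃[ t ] (index z < index t × Record v w t))
          later ¬later = ¬¬-minimum {A = ∃[ t ] ¬ C A t v w} (index ∘ proj₁) (v , C-irrefl)
            λ ((t , t∈) , t-min) → ¬later
              ( t
              , ≰⇒> (λ t≤z → early t t∈ (m≤n⇒m<n∨m≡n t≤z))
              , first-above⇒record t∈ λ u u<t → decidable-stable (C? u v w)
                  λ u∈ → <⇒≱ u<t (t-min (u , u∈)))
            where
            early : ∀ t → ¬ C A t v w → ¬ (index t < index z ⊎ index t ≡ index z)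
            early t t∈ (inj₁ t<z) = t∈ (xv≤vw (first (suc i) t t<z))
            early t t∈ (inj₂ t≡z) with refl ← index-injective t≡z = t∈ z∉vw

        -- A record of a twig later than `z` lies in the cone of `v i` that avoids `z`. For
        -- different `i` these cones leave the path to `x` at different nodes.
        later-disjoint : ∀ {i j t} → i < j → C A z (v i) t → ¬ C A z (v j) t
        later-disjoint {i} {j} i<j p q =
          C-asym (C-sym (C-trans (C-sym (chain-desc (s≤s i<j))) (apart j))) (C-trans q (C-sym p))

        splits : Splits (Nodes p q) (rec x (node 0))
        splits = record { bound = suc (index x) , rec-vanishes C-irrefl ; extend = unbounded }
          where
          module _ (N : ℕ) (¬new : ¬ (∃[ f ] (Nodes p q f × rec x (node 0) ≈[ N ] f ×
                                              ∃[ j ] (N ≤ j × f j ≡ true)))) where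

            Early : ℕ → Fin N → Set
            Early i k = ∃[ t ] (index t ≡ toℕ k × C A z (v i) t)

            early : ∀ i → ¬ ¬ (∃[ k ] Early i k)
            early i ¬early = later i λ (t , z<t , r) → ¬new
              ( rec (v i) (w i)
              , (v i , w i , chain (suc i) .proj₂ .proj₁ , twig (suc i) .proj₂ .proj₁
                , (λ eq → twig (suc i) .proj₂ .proj₂ .proj₁ (sym eq))
                , xv≤vw i ∘ below-cone (chain (suc i) .proj₂ .proj₂ .proj₂) ∘ pq≤xy , refl)
              , agrees
              , index t
              , ≮⇒≥ (λ t<N → too-early t t<N z<t r)
              , rec-true r )
              where
              too-early : ∀ t → index t < N → index z < index t → ¬ Record (v i) (w i) t
              too-early t t<N z<t r =
                ¬early (fromℕ< t<N , t , sym (toℕ-fromℕ< t<N) , r z z<t .proj₂)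

              agrees : rec x (node 0) ≈[ N ] rec (v i) (w i)
              -- Beyond `z` the records of `x ∧ node 0` have ended, and `too-early` excludes records
              -- of the twig below `N`.
              agrees n n<N with n ≤? index z
              ... | yes n≤z = agree i n n≤z
              ... | no  n≰z = trans (rec-vanishes z∈ n (≰⇒> n≰z)) (sym (dec-false
                (RecordAt? (v i) (w i) n)
                λ { (t , refl , r) → too-early t n<N (≰⇒> n≰z) r }))

            unbounded : ⊥
            -- Among `N + 1` twigs with early elements of index below `N`, two must share an
            -- element.
            unbounded = ¬¬-∀Fin {n = suc N} (λ i → early (toℕ i)) λ all →
              let (i , j , i<j , eq) = pigeonhole ≤-refl (λ i → all i .proj₁)
                  (t , t≡ , p) = all i .proj₂
                  (s , s≡ , q) = all j .proj₂
                  t≡s = index-injective (trans t≡ (trans (cong toℕ eq) (sym s≡)))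
              in later-disjoint i<j p (subst (C A z (v (toℕ j))) (sym t≡s) q)

    nodes-branching : ∀ {p q} → D p → D q → p ≢ q → Branching (Nodes p q)
    nodes-branching {p} {q} Dp Dq p≢q = record
      { member  = rec p q , p , q , Dp , Dq , p≢q , (λ r → r) , refl
      ; bounded = λ { _ (x , y , _ , _ , _ , _ , refl) → suc (index x) , rec-vanishes C-irrefl }
      ; split   = split
      }
      where
      split : ∀ f → Nodes p q f → ¬ ¬ (∃[ t ] (Splits (Nodes p q) t × f ⊑ t))
      split _ (x , y , Dx , Dy , x≢y , pq≤xy , refl) ¬split =
        -- The minimum is taken over all nodes `x ∧ v` above `x ∧ y` at once, so that one `z` serves
        -- the whole descending chain.
        ¬¬-minimum {A = ∃[ v ] ∃[ u ] ¬ C A u x (apex v)} (λ (_ , u , _) → index u)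
          (extend Dx Dy x≢y , x , C-irrefl)
          λ ((v , z , z∈) , z-min) → ¬split
            ( rec x (v .proj₁)
            , splits Dx Dy pq≤xy v z z∈ (λ v′ u u∈ → z-min (v′ , u , u∈))
            , below⇒⊑ (below-cone (v .proj₂ .proj₂ .proj₂)))
        where
        apex : Upper Dx Dy pq≤xy → Carrier A
        apex = proj₁

-- Fraïssé limits

enumeration : ∀ {X} → Countable X → Enumeration X
enumeration (inj₁ (n , X↔n)) = record
  { index           = toℕ ∘ Inverse.to X↔n
  ; index-injective = λ eq → Injection.injective (↔⇒↣ X↔n) (toℕ-injective eq)
  ; find            = find
  }
  where
  find : ∀ k → Dec (∃[ x ] toℕ (Inverse.to X↔n x) ≡ k)
  find k with k <? n
  ... | yes k<n = yes (Inverse.from X↔n (fromℕ< k<n) ,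
    trans (cong toℕ (Inverse.strictlyInverseˡ X↔n (fromℕ< k<n))) (toℕ-fromℕ< k<n))
  ... | no  k≮n = no λ { (x , refl) → k≮n (toℕ<n (Inverse.to X↔n x)) }
enumeration (inj₂ X↔ℕ) = record
  { index           = Inverse.to X↔ℕ
  ; index-injective = Injection.injective (↔⇒↣ X↔ℕ)
  ; find            = λ k → yes (Inverse.from X↔ℕ k , Inverse.strictlyInverseˡ X↔ℕ k)
  }

record FiniteFamily (X : Set) : Set₁ where
  field
    Index             : Set
    finite            : Finite Index
    element           : Index → X
    element-injective : Injective _≡_ _≡_ element

open FiniteFamily

-- The four points may coincide, so they are placed inside an injectively indexed finite family, to
-- which the age condition applies.
Cover : {X : Set} (x y z w : X) → Set₁
Cover x y z w = ∃[ F ]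
  (range (element F) x × range (element F) y × range (element F) z × range (element F) w)

cover : ∀ {X} → Countable X → (x y z w : X) → Cover x y z w
cover {X} (inj₁ X-finite) x y z w =
  record { Index = X ; finite = X-finite ; element = id ; element-injective = id } ,
  (x , refl) , (y , refl) , (z , refl) , (w , refl)
cover {X} (inj₂ X↔ℕ) x y z w =
  record { Index = Fin n ; finite = n , ↔-id _ ; element = el
         ; element-injective = λ eq →
             toℕ-injective (Injection.injective (↔⇒↣ (↔-sym X↔ℕ)) eq) } ,
  hit x (m≤n⇒m≤n⊔o (# w) (m≤n⇒m≤n⊔o (# z) (m≤m⊔n (# x) (# y)))) ,
  hit y (m≤n⇒m≤n⊔o (# w) (m≤n⇒m≤n⊔o (# z) (m≤n⊔m (# x) (# y)))) ,
  hit z (m≤n⇒m≤n⊔o (# w) (m≤n⊔m (# x ⊔ # y) (# z))) ,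
  hit w (m≤n⊔m (# x ⊔ # y ⊔ # z) (# w))
  where
  # : X → ℕ
  # = Inverse.to X↔ℕ

  n : ℕ
  n = suc (# x ⊔ # y ⊔ # z ⊔ # w)

  el : Fin n → X
  el i = Inverse.from X↔ℕ (toℕ i)

  hit : ∀ t → # t ≤ # x ⊔ # y ⊔ # z ⊔ # w → range el t
  hit t t≤ = fromℕ< (s≤s t≤) ,
    trans (cong (Inverse.from X↔ℕ) (toℕ-fromℕ< (s≤s t≤))) (Inverse.strictlyInverseʳ X↔ℕ t)

module _ {K : Pred Structure (lsuc 0ℓ)} {B : Structure}
         (K⇒C : ∀ {A} → K A → IsFiniteCRelation A) (L : IsFraïsséLimit K B) where

  restriction : FiniteFamily (Carrier B) → Structure
  restriction F = structure (Index F) λ i j k → C B (element F i) (element F j) (element F k)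

  restriction-isCSpace : ∀ F → IsCSpace (restriction F)
  restriction-isCSpace F = isFiniteCRelation⇒isCSpace (K⇒C (age L _ .from
    (finite F , element F , record { injective = element-injective F ; C-⇔ = λ _ _ _ → ⇔-id _ })))

  -- Each axiom concerns at most four points and holds in a finite restriction containing them,
  -- because that restriction belongs to `K`.
  fraïsséLimit-isCSpace : IsCSpace B
  fraïsséLimit-isCSpace = record
    { C?       = λ x y z → C? (cover (countable L) x y z z)
    ; C-sym    = λ {x} {y} {z} → C-sym (cover (countable L) x y z z)
    ; C-asym   = λ {x} {y} {z} → C-asym (cover (countable L) x y z z)
    ; C-branch = λ {x} {y} {z} w → C-branch (cover (countable L) x y z w)
    ; C-diag   = λ {x} {y} → C-diag (cover (countable L) x y y y)
    }
    where
    module R F = IsCSpace (restriction-isCSpace F)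

    module _ {x y z w : Carrier B} where

      C? : Cover x y z w → Dec (C B x y z)
      C? (F , (i , refl) , (j , refl) , (k , refl) , _) = R.C? F i j k

      C-sym : Cover x y z w → C B x y z → C B x z y
      C-sym (F , (i , refl) , (j , refl) , (k , refl) , _) = R.C-sym F {i} {j} {k}

      C-asym : Cover x y z w → C B x y z → ¬ C B y x z
      C-asym (F , (i , refl) , (j , refl) , (k , refl) , _) = R.C-asym F {i} {j} {k}

      C-branch : Cover x y z w → C B x y z → C B x y w ⊎ C B w y z
      C-branch (F , (i , refl) , (j , refl) , (k , refl) , (l , refl)) =
        R.C-branch F {i} {j} {k} l

      C-diag : Cover x y z w → x ≢ y → C B x y y
      C-diag (F , (i , refl) , (j , refl) , _) x≢y =
        R.C-diag F λ i≡j → x≢y (cong (element F) i≡j)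

-- Embeddings of the four-leaf structure and its membership in the binary class

open C₄-Exists using (C₄; isC₄; tree)

isC₄⇒isCSpace : ∀ {R} → IsC₄ R → IsCSpace (structure Label R)
isC₄⇒isCSpace C4 = isFiniteCRelation⇒isCSpace (IsC₄.isFiniteCRelation C4)

isC₄⇒crossing : ∀ {R} (C4 : IsC₄ R) → CSpaceProperties.Crossing (isC₄⇒isCSpace C4) a b c d
isC₄⇒crossing C4 = record
  { x≢y = λ () ; z≢w = λ () ; x∣zw = IsC₄.a∣cd C4 ; z∣xy = IsC₄.c∣ab C4 }

quadruple-id : ∀ l → quadruple a b c d l ≡ l
quadruple-id a = refl
quadruple-id b = refl
quadruple-id c = refl
quadruple-id d = refl

isC₄⇒⇔Split : ∀ {R} → IsC₄ R → ∀ l m n → R l m n ⇔ Split l m n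
isC₄⇒⇔Split {R} C4 l m n =
  subst (_⇔ Split l m n) eq (C⇔Split (isC₄⇒isCSpace C4) (isC₄⇒crossing C4) l m n)
  where
  eq : R (quadruple a b c d l) (quadruple a b c d m) (quadruple a b c d n) ≡ R l m n
  eq rewrite quadruple-id l | quadruple-id m | quadruple-id n = refl

quadruple-embedding : ∀ {R B x y z w} → IsC₄ R → (S : IsCSpace B) →
  CSpaceProperties.Crossing S x y z w → IsEmbedding (structure Label R) B (quadruple x y z w)
quadruple-embedding C4 S X = record
  { injective = quadruple-injective S X
  ; C-⇔       = λ l m n → ⇔-trans (isC₄⇒⇔Split C4 l m n) (⇔-sym (C⇔Split S X l m n))
  }

embedding-crossing : ∀ {R B h} → IsC₄ R → (S : IsCSpace B) → IsEmbedding (structure Label R) B h →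
  CSpaceProperties.Crossing S (h a) (h b) (h c) (h d)
embedding-crossing C4 S emb = record
  { x≢y  = λ eq → contradiction (injective emb eq) λ ()
  ; z≢w  = λ eq → contradiction (injective emb eq) λ ()
  ; x∣zw = C-⇔ emb _ _ _ .to (IsC₄.a∣cd C4)
  ; z∣xy = C-⇔ emb _ _ _ .to (IsC₄.c∣ab C4)
  }

tree-binary : Pseudotree.Binary tree
tree-binary l x y z (l≤x , l≢x) (l≤y , l≢y) (l≤z , l≢z) =
  from-yes (Fin.all? λ l → Fin.all? λ x → (l ≤ᵗ? x) →-dec (¬? (l Fin.≟ x) →-dec
    (Fin.all? λ y → (l ≤ᵗ? y) →-dec (¬? (l Fin.≟ y) →-dec
    (Fin.all? λ z → (l ≤ᵗ? z) →-dec (¬? (l Fin.≟ z) →-dec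
      ¬? ((l Fin.≟ x ∧ y) ×-dec ((l Fin.≟ x ∧ z) ×-dec (l Fin.≟ y ∧ z)))))))))
    l x l≤x l≢x y l≤y l≢y z l≤z l≢z
  where open C₄-Exists using (_∧_) renaming (_≤?_ to _≤ᵗ?_)

C₄-binary : IsFiniteBinaryCRelation (structure Label C₄)
C₄-binary = let (finite , T , nodes , rel) = IsC₄.isFiniteCRelation isC₄ in
  finite , T , nodes , tree-binary , rel

-- Extension properties of the limits

module Extension {K : Pred Structure (lsuc 0ℓ)} {B : Structure}
                 (K⇒C : ∀ {A} → K A → IsFiniteCRelation A) (KC₄ : K (structure Label C₄))
                 (L : IsFraïsséLimit K B) where

  space : IsCSpace B
  space = fraïsséLimit-isCSpace K⇒C L

  open CSpaceProperties space

  private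
    e : Label → Carrier B
    e = age L _ .to KC₄ .proj₂ .proj₁

    e-embedding : IsEmbedding (structure Label C₄) B e
    e-embedding = age L _ .to KC₄ .proj₂ .proj₂

    Distinct : Bool → Bool → Bool → Set
    Distinct i j k = i ≢ j × i ≢ k

    pair : Carrier B → Carrier B → Bool → Carrier B
    pair x y true  = x
    pair x y false = y

    -- On two points `C` expresses only distinctness, so homogeneity can move any pair of distinct
    -- points to any other.
    pair-embedding : ∀ {x y} → x ≢ y → IsEmbedding (structure Bool Distinct) B (pair x y)
    pair-embedding {x} {y} x≢y = record
      { injective = λ {i} {j} eq → decidable-stable (i Bool.≟ j) λ i≢j → distinct i≢j eq
      ; C-⇔       = λ i j k → mk⇔
          (λ (i≢j , i≢k) → subst (λ k → C B (pair x y i) (pair x y j) (pair x y k))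
            (trans (Bool.¬-not (i≢j ∘ sym)) (sym (Bool.¬-not (i≢k ∘ sym)))) (C-diag (distinct i≢j)))
          (λ p → C⇒≢ p ∘ cong (pair x y) , C⇒≢ (C-sym p) ∘ cong (pair x y))
      }
      where
      distinct : ∀ {i j} → i ≢ j → pair x y i ≢ pair x y j
      distinct {true}  {true}  i≢j _ = i≢j refl
      distinct {true}  {false} _     = x≢y
      distinct {false} {true}  _     = x≢y ∘ sym
      distinct {false} {false} i≢j _ = i≢j refl

  distinct-pair : ∃[ x ] ∃[ y ] x ≢ y
  distinct-pair = e a , e b , λ eq → contradiction (injective e-embedding eq) λ ()

  -- In a copy of `C₄`, the leaf `d` has the required position over `c` and `a`; an automorphism
  -- carries these two to `x` and `y`.
  extend : ∀ {x y} → x ≢ y → ∃[ v ] (v ≢ x × C B y x v)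
  extend {x} {y} x≢y
    with ultrahomogeneous L (structure Bool Distinct) (2 , ↔-sym 2↔Bool)
           (pair (e c) (e a)) (pair x y)
           (pair-embedding λ eq → contradiction (injective e-embedding eq) λ ()) (pair-embedding x≢y)
  ... | σ , (aut , _) , eq with refl ← eq true | refl ← eq false =
    σ (e d) , (λ eq′ → contradiction (injective e-embedding (injective aut eq′)) λ ()) ,
    C-⇔ aut _ _ _ .to (C-⇔ e-embedding _ _ _ .to (IsC₄.a∣cd isC₄))

  crossing-extend : ∀ {x y v} → v ≢ x → C B y x v → ∃[ w ] Crossing y w x v
  crossing-extend {x} {y} {v} v≢x p = let (w , w≢y , q) = extend (C⇒≢ p) in
    w , record { x≢y = w≢y ∘ sym ; z≢w = v≢x ∘ sym ; x∣zw = p ; z∣xy = q }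

  -- By homogeneity it suffices to find one such configuration over x and y.
  between : ∀ {x y v} → v ≢ x → C B y x v → ∃[ w ] (C B w x v × C B y x w)
  between {x} {y} {v} v≢x p
    with extend (C⇒≢ p ∘ sym) | crossing-extend v≢x p
  ... | w , w≢x , q | t , X with extend (w≢x ∘ sym)
  ...   | s , s≢x , r
    -- Both quadruples are copies of `C₄`. The automorphism fixes `y`, `t` and `x` and moves `s` to
    -- `v`, so it moves `w`, which is in position for `s`, into position for `v`.
    with ultrahomogeneous L (structure Label C₄) (IsC₄.isFiniteCRelation isC₄ .proj₁)
           (quadruple y t x s) (quadruple y t x v)
           (quadruple-embedding isC₄ space record
             { Crossing X ; z≢w = s≢x ∘ sym ; x∣zw = C-chain q r })
           (quadruple-embedding isC₄ space X)
  ...     | σ , (aut , _) , eq = σ w ,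
    subst₂ (C B (σ w)) (eq c) (eq d) (C-⇔ aut _ _ _ .to r) ,
    subst₂ (λ k l → C B k l (σ w)) (eq a) (eq c) (C-⇔ aut _ _ _ .to q)

-- The oscillation colouring

module _ {K : Pred Structure (lsuc 0ℓ)} {B : Structure}
         (K⇒C : ∀ {A} → K A → IsFiniteCRelation A) (KC₄ : K (structure Label C₄-Exists.C₄))
         (L : IsFraïsséLimit K B) where

  private
    module Ext = Extension K⇒C KC₄ L

  open CSpaceProperties Ext.space
  open Records Ext.space (enumeration (countable L))
  open Enumeration (enumeration (countable L)) using (index)

  -- Each leaf lies above its own node, so both record sets have ended here. The bracketing reduces
  -- each swap of leaves or of pairs to commutativity of the maximum.
  horizon : (x y z w : Carrier B) → ℕ
  horizon x y z w = suc ((index x ⊔ index y) ⊔ (index z ⊔ index w))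

  osc : (x y z w : Carrier B) → ℕ
  osc x y z w = blocks (rec x y) (rec z w) (horizon x y z w)

  osc-swapˡ : ∀ x y z w → osc y x z w ≡ osc x y z w
  osc-swapˡ x y z w rewrite ⊔-comm (index y) (index x) =
    cong proj₂ (run-cong {g = rec z w} (horizon x y z w) (λ n _ → rec-swap y x n) (λ _ _ → refl))

  osc-swapʳ : ∀ x y z w → osc x y w z ≡ osc x y z w
  osc-swapʳ x y z w rewrite ⊔-comm (index w) (index z) =
    cong proj₂ (run-cong {f = rec x y} (horizon x y z w) (λ _ _ → refl) (λ n _ → rec-swap w z n))

  osc-swap : ∀ x y z w → osc z w x y ≡ osc x y z w
  osc-swap x y z w rewrite ⊔-comm (index z ⊔ index w) (index x ⊔ index y) =
    cong proj₂ (run-mirror (rec x y) (rec z w) (horizon x y z w))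

  oscillation⇒osc : ∀ {x y z w k} → Oscillation (rec x y) (rec z w) k → osc x y z w ≡ k
  oscillation⇒osc {x} {y} {z} {w} (N , steady) =
    trans (sym (blocks-stable
            (vanishesFrom-mono (s≤s (m≤n⇒m≤n⊔o _ (m≤m⊔n (index x) (index y)))) (rec-vanishes C-irrefl))
            (vanishesFrom-mono (s≤s (m≤n⇒m≤o⊔n (index x ⊔ index y) (m≤m⊔n (index z) (index w))))
              (rec-vanishes C-irrefl))
            (m≤m⊔n M N)))
          (steady (M ⊔ N) (m≤n⊔m M N))
    where
    M : ℕ
    M = horizon x y z w

  -- The eight symmetries of ab|cd are generated by the three swaps above.
  osc-relabel : (h : Label → Carrier B) → ∀ {l m} → side l ≢ side m →
    osc (h l) (h (partner l)) (h m) (h (partner m)) ≡ osc (h a) (h b) (h c) (h d)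
  osc-relabel h {a} {a} ne = contradiction refl ne
  osc-relabel h {a} {b} ne = contradiction refl ne
  osc-relabel h {a} {c} _  = refl
  osc-relabel h {a} {d} _  = osc-swapʳ _ _ _ _
  osc-relabel h {b} {a} ne = contradiction refl ne
  osc-relabel h {b} {b} ne = contradiction refl ne
  osc-relabel h {b} {c} _  = osc-swapˡ _ _ _ _
  osc-relabel h {b} {d} _  = trans (osc-swapˡ _ _ _ _) (osc-swapʳ _ _ _ _)
  osc-relabel h {c} {a} _  = osc-swap _ _ _ _
  osc-relabel h {c} {b} _  = trans (osc-swapʳ _ _ _ _) (osc-swap _ _ _ _)
  osc-relabel h {c} {c} ne = contradiction refl ne
  osc-relabel h {c} {d} ne = contradiction refl ne
  osc-relabel h {d} {a} _  = trans (osc-swapˡ _ _ _ _) (osc-swap _ _ _ _)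
  osc-relabel h {d} {b} _  =
    trans (osc-swapˡ _ _ _ _) (trans (osc-swapʳ _ _ _ _) (osc-swap _ _ _ _))
  osc-relabel h {d} {c} ne = contradiction refl ne
  osc-relabel h {d} {d} ne = contradiction refl ne

  module _ {R : Label → Label → Label → Set} (C4 : IsC₄ R) where

    cone⇒partner : ∀ {h k l m} → IsEmbedding (structure Label R) B h →
                   h l ≢ h m → C B (h k) (h l) (h m) → m ≡ partner l
    cone⇒partner {h} {k} {l} {m} emb hl≢hm p = same-side⇒partner (hl≢hm ∘ cong h)
      (isC₄⇒⇔Split C4 k l m .to (C-⇔ emb k l m .from p) .proj₂ .proj₂)

    -- A crossing inside the range is paired as in the tree, so it comes from `h` by a symmetry of
    -- ab|cd. Hence the colour depends on the set of a copy alone.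
    osc-range : ∀ {h x y z w} → IsEmbedding (structure Label R) B h → Crossing x y z w →
                range h x → range h y → range h z → range h w →
                osc x y z w ≡ osc (h a) (h b) (h c) (h d)
    osc-range {h} emb X (k , refl) (l , refl) (m , refl) (n , refl)
      with refl ← cone⇒partner {k = m} emb (X .Crossing.x≢y) (X .Crossing.z∣xy)
         | refl ← cone⇒partner {k = k} emb (X .Crossing.z≢w) (X .Crossing.x∣zw) =
      osc-relabel h λ eq → C⇒≢ (C-sym z∣xy)
        (cong h (same-side⇒partner (C⇒≢ x∣zw ∘ cong h) eq))
      where open Crossing X

    oscColouring : ∀ ℓ → Colouring B (structure Label R) (suc ℓ)
    oscColouring ℓ = record
      { colour   = λ S → let h = Copy.iso S in osc (h a) (h b) (h c) (h d) mod suc ℓ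
      ; respects = λ S S′ (S⊆S′ , _) →
          let covered = λ l → Copy.onto S′ .proj₁ (S⊆S′ (Copy.onto S .proj₂ (l , refl))) in
          cong (_mod suc ℓ) (osc-range (Copy.isEmbedding S′)
            (embedding-crossing C4 Ext.space (Copy.isEmbedding S))
            (covered a) (covered b) (covered c) (covered d))
      }

    range-rich : ∀ {f} → IsEmbedding B B f → IsRich (range f)
    range-rich {f} emb = record { extend = extend ; between = between }
      where
      extend : ∀ {x y} → range f x → range f y → x ≢ y → ∃[ v ] (range f v × v ≢ x × C B y x v)
      extend (x , refl) (y , refl) fx≢fy =
        let (v , v≢x , p) = Ext.extend (fx≢fy ∘ cong f) in
        f v , (v , refl) , v≢x ∘ injective emb , C-⇔ emb y x v .to p

      between : ∀ {x y v} → range f x → range f y → range f v → v ≢ x → C B y x v →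
                ∃[ w ] (range f w × C B w x v × C B y x w)
      between (x , refl) (y , refl) (v , refl) fv≢fx p =
        let (w , q , r) = Ext.between (fv≢fx ∘ cong f) (C-⇔ emb y x v .from p) in
        f w , (w , refl) , C-⇔ emb w x v .to q , C-⇔ emb y x w .to r

    range-crossing : ∀ {f} → IsEmbedding B B f →
      ∃[ x ] ∃[ y ] ∃[ z ] ∃[ w ] Crossing (f x) (f y) (f z) (f w)
    range-crossing emb =
      let (x , y , x≢y)   = Ext.distinct-pair
          (v , v≢x , p)   = Ext.extend x≢y
          (w , X)         = Ext.crossing-extend v≢x p
          open Crossing X renaming (x≢y to y≢w; z≢w to x≢v; x∣zw to y∣xv; z∣xy to x∣yw)
      in y , w , x , v , record
        { x≢y  = y≢w ∘ injective emb
        ; z≢w  = x≢v ∘ injective emb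
        ; x∣zw = C-⇔ emb _ _ _ .to y∣xv
        ; z∣xy = C-⇔ emb _ _ _ .to x∣yw
        }

    oscColouring-surjective : ∀ ℓ (D : Copy B B) i → ¬ ¬ Image (oscColouring ℓ) D i
    oscColouring-surjective ℓ D i ¬image =
      let (p , q , r , s , X) = range-crossing D-embedding
          open Crossing X
      in
      oscillates-cofinitely
        (nodes-branching rich (p , refl) (q , refl) x≢y)
        (nodes-branching rich (r , refl) (s , refl) z≢w)
        λ (m , oscillates) →
      -- Together with the unknown offset `m` this makes `toℕ i + m * suc ℓ`, whose residue is `i`.
      oscillates (toℕ i + m * ℓ)
        λ { (_ , _ , (x , y , Dx , Dy , x≢y , pq≤xy , refl)
                   , (z , w , Dz , Dw , z≢w , rs≤zw , refl) , osc-k) →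
      ¬image
        ( record
            { set         = range (quadruple x y z w)
            ; iso         = quadruple x y z w
            ; isEmbedding = quadruple-embedding C4 Ext.space
                              (crossing-above X pq≤xy rs≤zw x≢y z≢w)
            ; onto        = id , id
            }
        , (λ { (a , refl) → D-onto Dx ; (b , refl) → D-onto Dy
             ; (c , refl) → D-onto Dz ; (d , refl) → D-onto Dw })
        , trans (cong (_mod suc ℓ) (oscillation⇒osc osc-k)) (residue m)) }
      where
      D-embedding : IsEmbedding B B (Copy.iso D)
      D-embedding = Copy.isEmbedding D

      D-onto : range (Copy.iso D) ⊆ set D
      D-onto = Copy.onto D .proj₂

      rich : IsRich (range (Copy.iso D))
      rich = range-rich D-embedding

      residue : ∀ m → (toℕ i + m * ℓ + m) mod suc ℓ ≡ i
      residue m = toℕ-injective (begin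
        toℕ ((toℕ i + m * ℓ + m) mod suc ℓ) ≡⟨ toℕ-fromℕ< _ ⟩
        (toℕ i + m * ℓ + m) % suc ℓ         ≡⟨ cong (_% suc ℓ) (+-assoc (toℕ i) (m * ℓ) m) ⟩
        (toℕ i + (m * ℓ + m)) % suc ℓ
          ≡⟨ cong (λ n → (toℕ i + n) % suc ℓ) (trans (+-comm (m * ℓ) m) (sym (*-suc m ℓ))) ⟩
        (toℕ i + m * suc ℓ) % suc ℓ         ≡⟨ [m+kn]%n≡m%n (toℕ i) m (suc ℓ) ⟩
        toℕ i % suc ℓ                       ≡⟨ m<n⇒m%n≡m (toℕ<n i) ⟩
        toℕ i                               ∎)
        where open ≡-Reasoning

    -- That a colour is omitted is a negative statement, so attaining each of the finitely many
    -- colours up to double negation refutes it.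
    bigRamseyDegree-∞ : BigRamseyDegree B (structure Label R) ∞
    bigRamseyDegree-∞ (ℓ , arrow) =
      let (D , ¬universal) = arrow (oscColouring ℓ) in
      ¬¬-∀Fin (oscColouring-surjective ℓ D) ¬universal

theorem11 : ∀ (Cω C₂ : Structure) →
    IsFraïsséLimit IsFiniteCRelation Cω →
    IsFraïsséLimit IsFiniteBinaryCRelation C₂ →
    ∀ (R : Label → Label → Label → Set) → IsC₄ R →
    BigRamseyDegree C₂ (structure Label R) ∞ ×
    BigRamseyDegree Cω (structure Label R) ∞
theorem11 Cω C₂ Lω L₂ R C4 =
  bigRamseyDegree-∞ (λ (finite , T , nodes , _ , rel) → finite , T , nodes , rel) C₄-binary L₂ C4 ,
  bigRamseyDegree-∞ id (IsC₄.isFiniteCRelation C₄-Exists.isC₄) Lω C4
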